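{- Let $\mathrm{REACH}$ be the set of finite ordered directed graphs that have a directed path from the first vertex $\min$ to the last vertex $\max$ (equivalently, for which $(\min,\max)$ lies in the reflexive, transitive closure of the edge relation), and let $\overline{\mathrm{REACH}}$ be its complement, i.e. the set of finite ordered directed graphs that have no directed path from $\min$ to $\max$. Then $\overline{\mathrm{REACH}}\le_{\mathrm{qfp}}\mathrm{REACH}$; that is, there is a quantifier-free projection $I$ from ordered directed graphs to ordered directed graphs such that for every finite ordered directed graph $G$, $G\in\overline{\mathrm{REACH}}$ if and only if $I(G)\in\mathrm{REACH}$.
   Context: **Ordered structures.** All structures are finite and ordered: a structure $\mathcal A=(A,R_1,\dots,R_r)$ of a finite relational vocabulary $\sigma$ (the input relations) comes with a total ordering of its universe $A$. Formulas of vocabulary $\sigma$ may use, besides the input relation symbols and equality, the numeric symbols $\min,\max$ (constants for the first and last elements of the ordering) and $\mathrm{suc}$ (the binary successor relation of the ordering: $\mathrm{suc}(x,y)$ iff $y$ is the immediate successor of $x$). A numeric formula is one that uses only logical symbols (including $=$) and numeric symbols, and no input relation symbols. An ordered directed graph is an ordered structure with one binary input relation $E$ (the edge relation). A decision problem is a set of finite ordered structures of a fixed vocabulary. **First-order mappings and reductions.** Let $\sigma$ and $\tau=\langle R_1^{a_1},\dots,R_r^{a_r}\rangle$ be vocabularies ($R_i$ has arity $a_i$) and let $k$ be a fixed natural number. A $k$-ary first-order mapping $I$ from $\sigma$-structures to $\tau$-structures is given by first-order formulas $\phi_1,\dots,\phi_r$ of vocabulary $\sigma$, where $\phi_i$ has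 $k a_i$ free variables. For a $\sigma$-structure $\mathcal A$ with universe $A$, $I(\mathcal A)$ has universe $A^k$, ordered lexicographically (so its $\min$, $\max$, $\mathrm{suc}$ are those of the lexicographic order), and $$R_i^{I(\mathcal A)}=\{(\langle b_1^1,\dots,b_1^k\rangle,\dots,\langle b_{a_i}^1,\dots,b_{a_i}^k\rangle)\in (A^k)^{a_i} : \mathcal A\models\phi_i(b_1^1,\dots,b_{a_i}^k)\}.$$ A first-order reduction from a problem $S$ to a problem $T$ is a first-order mapping $I$ such that $\mathcal A\in S\iff I(\mathcal A)\in T$ for all $\mathcal A$. **Quantifier-free projections.** A first-order reduction $I=\langle\phi_1,\dots,\phi_r\rangle$ is a first-order projection if each $\phi_i$ has the form $$\phi_i\equiv \alpha_1\lor(\alpha_2\land\lambda_2)\lor\cdots\lor(\alpha_e\land\lambda_e),$$ where the $\alpha_j$ are mutually exclusive numeric formulas and each $\lambda_j$ is a literal, i.e. an atomic formula $P(x_{j_1},\dots,x_{j_a})$ with $P$ an input relation symbol, or the negation of one. If in addition all the formulas $\phi_i$ are quantifier-free, $I$ is a quantifier-free projection (qfp), and one writes $S\le_{\mathrm{qfp}}T$ to mean that $S$ is reducible to $T$ via a qfp.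
   Formalization: All structures are taken to have at least two elements (min ≠ max), also in the mutual exclusivity of the numeric formulas; for a one-vertex graph both G and I(G) lie in REACH for every mapping I, so the claim fails there. -}

module Defs where

open import Data.Empty using (⊥)
open import Data.Fin using (Fin; zero)
import Data.Fin.Properties as Fin
open import Data.List using (List; _∷_; foldl; map)
open import Data.List.Relation.Unary.All using (All)
open import Data.List.Relation.Unary.AllPairs using (AllPairs)
open import Data.Nat using (ℕ; zero; suc; _*_; _^_; NonZero)
open import Data.Product using (∃; _×_; _,_; proj₁; Σ-syntax)
open import Data.Product.Function.NonDependent.Propositional using (_×-↔_)
open import Data.Sum using (_⊎_)
open import Data.Unit using (⊤)
open import Data.Vec using (Vec; []; _∷_; concat; lookup; replicate)
import Data.Vec as Vec
open import Data.Vec.Relation.Binary.Lex.Strict as Lex using (Lex-<; base; this; next)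
open import Data.Vec.Relation.Binary.Pointwise.Inductive using (Pointwise-≡⇒≡; ≡⇒Pointwise-≡)
open import Function.Base using (_∘_)
open import Function.Bundles using (_↔_; _⇔_; Inverse; mk↔ₛ′)
open import Function.Construct.Composition using (_↔-∘_)
open import Function.Construct.Symmetry using (↔-sym)
open import Level using (0ℓ)
open import Relation.Binary.Construct.Closure.ReflexiveTransitive using (Star)
open import Relation.Binary.Core using (Rel)
open import Relation.Binary.Definitions using (tri<; tri≈; tri>)
open import Relation.Binary.PropositionalEquality using (_≡_; _≢_; refl; sym; cong; subst; isEquivalence; resp₂)
open import Relation.Binary.Structures using (IsStrictTotalOrder)
open import Relation.Nullary using (¬_; Dec)
open import Relation.Nullary.Decidable using (map′; ¬?; _×-dec_; _⊎-dec_)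
open import Relation.Unary using (Pred; Decidable)

-- Finite total orders.  The usual proviso of descriptive complexity, that a
-- universe has at least two elements (min ≠ max), is part of the definition.
-- It cannot be dropped: over a one-element universe the path from min to max
-- is always the empty one, so there no mapping reduces the complement of
-- REACH to REACH.
record FiniteOrder : Set₁ where
  infix 4 _<_
  field
    Carrier            : Set
    _<_                : Rel Carrier 0ℓ
    isStrictTotalOrder : IsStrictTotalOrder _≡_ _<_
    size               : ℕ
    enumeration        : Carrier ↔ Fin size
    min max            : Carrier
    min-least          : ∀ x → ¬ (x < min)
    max-greatest       : ∀ x → ¬ (max < x)
    min≢max            : min ≢ max

  open IsStrictTotalOrder isStrictTotalOrder public using (compare; _≟_; _<?_)

  Succ : Rel Carrier 0ℓ
  Succ x y = x < y × ¬ (∃ λ z → x < z × z < y)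

  any? : {P : Pred Carrier 0ℓ} → Decidable P → Dec (∃ P)
  any? {P} P? =
    map′ (λ { (i , p) → from i , p })
         (λ { (x , p) → to x , subst P (sym (strictlyInverseʳ x)) p })
         (Fin.any? (P? ∘ from))
    where open Inverse enumeration

  all? : {P : Pred Carrier 0ℓ} → Decidable P → Dec (∀ x → P x)
  all? {P} P? =
    map′ (λ h x → subst P (strictlyInverseʳ x) (h (to x)))
         (λ h i → h (from i))
         (Fin.all? (P? ∘ from))
    where open Inverse enumeration

  Succ? : ∀ x y → Dec (Succ x y)
  Succ? x y = (x <? y) ×-dec ¬? (any? λ z → (x <? z) ×-dec (z <? y))

module _ (O : FiniteOrder) where
  open FiniteOrder O

  private
    infix 4 _<ₗ_
    _<ₗ_ : ∀ {k} → Rel (Vec Carrier k) 0ℓ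
    _<ₗ_ = Lex-< _≡_ _<_

    lexIsStrictTotalOrder : ∀ k → IsStrictTotalOrder _≡_ (_<ₗ_ {k})
    lexIsStrictTotalOrder k = record
      { isStrictPartialOrder = record
        { isEquivalence = isEquivalence
        ; irrefl        = λ eq → L.irrefl (≡⇒Pointwise-≡ eq)
        ; trans         = L.trans
        ; <-resp-≈      = resp₂ _<ₗ_
        }
      ; compare = cmp
      }
      where
      module L = IsStrictTotalOrder (Lex.<-isStrictTotalOrder isStrictTotalOrder {k})
      cmp : ∀ xs ys → _
      cmp xs ys with L.compare xs ys
      ... | tri< a b c = tri< a (b ∘ ≡⇒Pointwise-≡) c
      ... | tri≈ a b c = tri≈ a (Pointwise-≡⇒≡ b) c
      ... | tri> a b c = tri> a (b ∘ ≡⇒Pointwise-≡) c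

    vecEnumeration : ∀ k → Vec Carrier k ↔ Fin (size ^ k)
    vecEnumeration zero    =
      mk↔ₛ′ (λ _ → zero) (λ _ → []) (λ { zero → refl }) (λ { [] → refl })
    vecEnumeration (suc k) =
      ↔-sym Fin.*↔× ↔-∘ ((enumeration ×-↔ vecEnumeration k) ↔-∘ uncons↔)
      where
      uncons↔ : Vec Carrier (suc k) ↔ (Carrier × Vec Carrier k)
      uncons↔ = mk↔ₛ′ Vec.uncons (λ { (x , xs) → x ∷ xs })
                      (λ _ → refl) (λ { (_ ∷ _) → refl })

    replicate-min-least : ∀ k (xs : Vec Carrier k) → ¬ (xs <ₗ replicate k min)
    replicate-min-least zero    []       (base ())
    replicate-min-least (suc k) (x ∷ xs) (this x<m _)    = min-least x x<m
    replicate-min-least (suc k) (x ∷ xs) (next _ xs<min) = replicate-min-least k xs xs<min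

    replicate-max-greatest : ∀ k (xs : Vec Carrier k) → ¬ (replicate k max <ₗ xs)
    replicate-max-greatest zero    []       (base ())
    replicate-max-greatest (suc k) (x ∷ xs) (this m<x _)    = max-greatest x m<x
    replicate-max-greatest (suc k) (x ∷ xs) (next _ max<xs) = replicate-max-greatest k xs max<xs

    replicate-min≢max : ∀ k .{{_ : NonZero k}} → replicate k min ≢ replicate k max
    replicate-min≢max (suc k) eq = min≢max (cong Vec.head eq)

  lexPower : (k : ℕ) .{{_ : NonZero k}} → FiniteOrder
  lexPower k = record
    { Carrier            = Vec Carrier k
    ; _<_                = _<ₗ_
    ; isStrictTotalOrder = lexIsStrictTotalOrder k
    ; size               = size ^ k
    ; enumeration        = vecEnumeration k
    ; min                = replicate k min
    ; max                = replicate k max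
    ; min-least          = replicate-min-least k
    ; max-greatest       = replicate-max-greatest k
    ; min≢max            = replicate-min≢max k
    }

record Vocabulary : Set where
  field
    relations : ℕ
    arity     : Fin relations → ℕ

open Vocabulary public

-- Relations are decidable, as all relations on a finite set are classically.
record Structure (σ : Vocabulary) : Set₁ where
  field
    order : FiniteOrder

  open FiniteOrder order public

  field
    R  : (i : Fin (relations σ)) → Pred (Vec Carrier (arity σ i)) 0ℓ
    R? : (i : Fin (relations σ)) → Decidable (R i)

Problem : Vocabulary → Set₁
Problem σ = Pred (Structure σ) 0ℓ

data Term (n : ℕ) : Set where
  var     : Fin n → Term n
  min max : Term n

-- Formulas with free variables among n; the quantifiers bind de Bruijn
-- variable zero.
data Formula (σ : Vocabulary) : ℕ → Set where
  _≐_  : ∀ {n} → Term n → Term n → Formula σ n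
  succ : ∀ {n} → Term n → Term n → Formula σ n
  rel  : ∀ {n} (i : Fin (relations σ)) → Vec (Term n) (arity σ i) → Formula σ n
  ∼_   : ∀ {n} → Formula σ n → Formula σ n
  _∧_  : ∀ {n} → Formula σ n → Formula σ n → Formula σ n
  _∨_  : ∀ {n} → Formula σ n → Formula σ n → Formula σ n
  all  : ∀ {n} → Formula σ (suc n) → Formula σ n
  ex   : ∀ {n} → Formula σ (suc n) → Formula σ n

infix  8 _≐_
infix  7 ∼_
infixr 6 _∧_
infixl 5 _∨_

module _ {σ : Vocabulary} (A : Structure σ) where
  private module A = Structure A

  eval : ∀ {n} → Vec A.Carrier n → Term n → A.Carrier
  eval ρ (var i) = lookup ρ i
  eval ρ min     = A.min
  eval ρ max     = A.max

  Sat : ∀ {n} → Vec A.Carrier n → Formula σ n → Set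
  Sat ρ (s ≐ t)    = eval ρ s ≡ eval ρ t
  Sat ρ (succ s t) = A.Succ (eval ρ s) (eval ρ t)
  Sat ρ (rel i ts) = A.R i (Vec.map (eval ρ) ts)
  Sat ρ (∼ φ)      = ¬ Sat ρ φ
  Sat ρ (φ ∧ ψ)    = Sat ρ φ × Sat ρ ψ
  Sat ρ (φ ∨ ψ)    = Sat ρ φ ⊎ Sat ρ ψ
  Sat ρ (all φ)    = ∀ x → Sat (x ∷ ρ) φ
  Sat ρ (ex φ)     = ∃ λ x → Sat (x ∷ ρ) φ

  Sat? : ∀ {n} (ρ : Vec A.Carrier n) (φ : Formula σ n) → Dec (Sat ρ φ)
  Sat? ρ (s ≐ t)    = eval ρ s A.≟ eval ρ t
  Sat? ρ (succ s t) = A.Succ? (eval ρ s) (eval ρ t)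
  Sat? ρ (rel i ts) = A.R? i (Vec.map (eval ρ) ts)
  Sat? ρ (∼ φ)      = ¬? (Sat? ρ φ)
  Sat? ρ (φ ∧ ψ)    = Sat? ρ φ ×-dec Sat? ρ ψ
  Sat? ρ (φ ∨ ψ)    = Sat? ρ φ ⊎-dec Sat? ρ ψ
  Sat? ρ (all φ)    = A.all? λ x → Sat? (x ∷ ρ) φ
  Sat? ρ (ex φ)     = A.any? λ x → Sat? (x ∷ ρ) φ

Numeric : ∀ {σ n} → Formula σ n → Set
Numeric (s ≐ t)    = ⊤
Numeric (succ s t) = ⊤
Numeric (rel i ts) = ⊥
Numeric (∼ φ)      = Numeric φ
Numeric (φ ∧ ψ)    = Numeric φ × Numeric ψ
Numeric (φ ∨ ψ)    = Numeric φ × Numeric ψ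
Numeric (all φ)    = Numeric φ
Numeric (ex φ)     = Numeric φ

QuantifierFree : ∀ {σ n} → Formula σ n → Set
QuantifierFree (s ≐ t)    = ⊤
QuantifierFree (succ s t) = ⊤
QuantifierFree (rel i ts) = ⊤
QuantifierFree (∼ φ)      = QuantifierFree φ
QuantifierFree (φ ∧ ψ)    = QuantifierFree φ × QuantifierFree ψ
QuantifierFree (φ ∨ ψ)    = QuantifierFree φ × QuantifierFree ψ
QuantifierFree (all φ)    = ⊥
QuantifierFree (ex φ)     = ⊥

MutuallyExclusive : ∀ {σ n} → Formula σ n → Formula σ n → Set₁
MutuallyExclusive {σ} {n} α β =
  (A : Structure σ) (ρ : Vec (Structure.Carrier A) n) → ¬ (Sat A ρ α × Sat A ρ β)

-- The arguments of a literal are variables, not the constants min and max.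
data Literal (σ : Vocabulary) (n : ℕ) : Set where
  pos neg : (i : Fin (relations σ)) → Vec (Fin n) (arity σ i) → Literal σ n

literal : ∀ {σ n} → Literal σ n → Formula σ n
literal (pos i xs) = rel i (Vec.map var xs)
literal (neg i xs) = ∼ rel i (Vec.map var xs)

record ProjectionForm {σ : Vocabulary} {n : ℕ} (φ : Formula σ n) : Set₁ where
  field
    α₁      : Formula σ n
    guarded : List (Formula σ n × Literal σ n)

  guards : List (Formula σ n)
  guards = α₁ ∷ map proj₁ guarded

  field
    form      : φ ≡ foldl (λ ψ (α , l) → ψ ∨ (α ∧ literal l)) α₁ guarded
    numeric   : All Numeric guards
    exclusive : AllPairs MutuallyExclusive guards

-- The width is positive, as A⁰ would have a single element.
record FOMapping (σ τ : Vocabulary) : Set where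
  field
    k             : ℕ
    {{k-nonZero}} : NonZero k
    formula       : (i : Fin (relations τ)) → Formula σ (arity τ i * k)

  -- concat lists b₁¹,…,b₁ᵏ,…,bₐ¹,…,bₐᵏ in this order.
  apply : Structure σ → Structure τ
  apply A = record
    { order = lexPower (Structure.order A) k
    ; R     = λ i bs → Sat A (concat bs) (formula i)
    ; R?    = λ i bs → Sat? A (concat bs) (formula i)
    }

IsReduction : ∀ {σ τ} → FOMapping σ τ → Problem σ → Problem τ → Set₁
IsReduction I S T = ∀ A → S A ⇔ T (FOMapping.apply I A)

IsProjection : ∀ {σ τ} → FOMapping σ τ → Set₁
IsProjection I = ∀ i → ProjectionForm (FOMapping.formula I i)

IsQuantifierFree : ∀ {σ τ} → FOMapping σ τ → Set
IsQuantifierFree I = ∀ i → QuantifierFree (FOMapping.formula I i)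

infix 4 _≤qfp_
_≤qfp_ : ∀ {σ τ} → Problem σ → Problem τ → Set₁
_≤qfp_ {σ} {τ} S T =
  Σ[ I ∈ FOMapping σ τ ] IsReduction I S T × IsProjection I × IsQuantifierFree I

graphVocabulary : Vocabulary
graphVocabulary = record { relations = 1 ; arity = λ _ → 2 }

Edge : (G : Structure graphVocabulary) → Rel (Structure.Carrier G) 0ℓ
Edge G x y = Structure.R G zero (x ∷ y ∷ [])

REACH : Problem graphVocabulary
REACH G = Star (Edge G) (Structure.min G) (Structure.max G)

{-# OPTIONS --safe #-}

-- Inductive counting (Immerman, Szelepcsényi).  Knowing the number of vertices
-- of the layer d, that is, of those at distance less than d from min, a nondeterministic
-- machine certifies that v is not in the next layer by guessing, for that many
-- vertices u without an edge to v, a path witnessing that u is in the layer d.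
-- Going through all v in order, it computes the size of the next layer.  It gets
-- through a stage only if max is not in that layer, and accepts when two
-- consecutive layers have the same size, hence are equal.  A configuration is a
-- tuple of vertices, numbers being represented by their ranks, and every
-- transition tests at most one literal of the input, so that the configuration
-- graph is a quantifier-free projection of the input graph.
module Submission where

open import Defs
open import Data.Bool using (true)
open import Data.Empty using (⊥)
open import Data.Fin using (Fin; zero; suc; _↑ˡ_; _↑ʳ_)
open import Data.Fin.Patterns using (0F; 1F; 2F; 3F; 4F; 5F; 6F; 7F; 8F; 9F)
open import Data.Fin.Subset using (Subset; ∣_∣; ⁅_⁆; _∪_; outside; inside)
  renaming (_⊆_ to _⊆ₛ_; _∈_ to _∈ₛ_)
open import Data.Fin.Subset.Properties
  using (∪-identityʳ; Empty-unique; ∣⊥∣≡0; p⊆q⇒∣p∣≤∣q∣; p⊂q⇒∣p∣<∣q∣; x∈p∪q⁺; x∈⁅x⁆)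
open import Data.List using ([]; _∷_)
open import Data.List.Relation.Unary.All using ([]; _∷_)
open import Data.List.Relation.Unary.AllPairs using ([]; _∷_)
open import Data.Nat as ℕ using (ℕ; zero; suc; _≤_; z≤n; s≤s)
import Data.Nat.Properties as ℕ
open import Data.Product using (∃; _×_; _,_; proj₁; proj₂)
open import Data.Sum as Sum using (_⊎_; inj₁; inj₂; [_,_])
open import Data.Unit using (⊤; tt)
open import Data.Vec using (Vec; []; _∷_; replicate; tabulate)
open import Data.Vec.Properties using (lookup∘tabulate; lookup⇒[]=; []=⇒lookup)
open import Function.Base using (_∘_; id)
open import Function.Bundles using (Inverse; mk⇔)
open import Level using (0ℓ)
open import Relation.Binary.Construct.Closure.ReflexiveTransitive using (Star; ε; _◅_; _◅◅_; gmap)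
open import Relation.Binary.Core using (Rel)
open import Relation.Binary.Definitions using (tri<; tri≈; tri>)
open import Relation.Binary.PropositionalEquality
  using (_≡_; _≢_; refl; sym; trans; cong; subst; subst₂)
open import Relation.Binary.Structures using (IsStrictTotalOrder)
open import Relation.Nullary using (¬_; yes; no; does; contradiction)
open import Relation.Nullary.Decidable using (_×-dec_; _⊎-dec_; dec-true)
open import Relation.Unary using (Pred; Decidable; ∁; _⊆_)

∣p∪⁅x⁆∣≤1+∣p∣ : ∀ {n} (p : Subset n) (x : Fin n) → ∣ p ∪ ⁅ x ⁆ ∣ ≤ suc ∣ p ∣
∣p∪⁅x⁆∣≤1+∣p∣ (outside ∷ p) zero    = s≤s (ℕ.≤-reflexive (cong ∣_∣ (∪-identityʳ p)))
∣p∪⁅x⁆∣≤1+∣p∣ (inside  ∷ p) zero    = s≤s (ℕ.m≤n⇒m≤1+n (ℕ.≤-reflexive (cong ∣_∣ (∪-identityʳ p))))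
∣p∪⁅x⁆∣≤1+∣p∣ (outside ∷ p) (suc x) = ∣p∪⁅x⁆∣≤1+∣p∣ p x
∣p∪⁅x⁆∣≤1+∣p∣ (inside  ∷ p) (suc x) = s≤s (∣p∪⁅x⁆∣≤1+∣p∣ p x)

-- Counting in finite orders

module Counting (O : FiniteOrder) where
  open FiniteOrder O renaming (min to first; max to last)
  open Inverse enumeration
  open IsStrictTotalOrder isStrictTotalOrder using (irrefl) renaming (trans to <-trans)

  subset : {P : Pred Carrier 0ℓ} → Decidable P → Subset size
  subset P? = tabulate (does ∘ P? ∘ from)

  card : {P : Pred Carrier 0ℓ} → Decidable P → ℕ
  card P? = ∣ subset P? ∣

  module _ {P : Pred Carrier 0ℓ} (P? : Decidable P) where

    ∈-subset⁺ : ∀ {i} → P (from i) → i ∈ₛ subset P?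
    ∈-subset⁺ {i} p = lookup⇒[]= i _ (trans (lookup∘tabulate _ i) (dec-true (P? (from i)) p))

    ∈-subset⁻ : ∀ {i} → i ∈ₛ subset P? → P (from i)
    ∈-subset⁻ {i} i∈ with P? (from i) in eq
    ... | yes p = p
    ... | no  _ with () ← trans (sym ([]=⇒lookup i∈)) (trans (lookup∘tabulate _ i) (cong does eq))

    card-empty : (∀ x → ¬ P x) → card P? ≡ 0
    card-empty ¬P = trans (cong ∣_∣ (Empty-unique λ (i , i∈) → ¬P _ (∈-subset⁻ i∈))) (∣⊥∣≡0 size)

  module _ {P Q : Pred Carrier 0ℓ} (P? : Decidable P) (Q? : Decidable Q) where

    subset-mono : P ⊆ Q → subset P? ⊆ₛ subset Q?
    subset-mono P⊆Q = ∈-subset⁺ Q? ∘ P⊆Q ∘ ∈-subset⁻ P?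

    card-mono : P ⊆ Q → card P? ≤ card Q?
    card-mono P⊆Q = p⊆q⇒∣p∣≤∣q∣ (subset-mono P⊆Q)

    card-strict : P ⊆ Q → ∀ {z} → Q z → ¬ P z → card P? ℕ.< card Q?
    card-strict P⊆Q {z} Qz ¬Pz = p⊂q⇒∣p∣<∣q∣
      ( subset-mono P⊆Q
      , to z
      , ∈-subset⁺ Q? (subst Q (sym (strictlyInverseʳ z)) Qz)
      , ¬Pz ∘ subst P (strictlyInverseʳ z) ∘ ∈-subset⁻ P?)

    card-insert : ∀ z → (∀ {x} → Q x → P x ⊎ x ≡ z) → card Q? ≤ suc (card P?)
    card-insert z Q⊆P∪z =
      ℕ.≤-trans (p⊆q⇒∣p∣≤∣q∣ Q⊆) (∣p∪⁅x⁆∣≤1+∣p∣ (subset P?) (to z))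
      where
      Q⊆ : subset Q? ⊆ₛ subset P? ∪ ⁅ to z ⁆
      Q⊆ {i} i∈ = x∈p∪q⁺ (Sum.map (∈-subset⁺ P?) i≡z (Q⊆P∪z (∈-subset⁻ Q? i∈)))
        where
        i≡z : from i ≡ z → i ∈ₛ ⁅ to z ⁆
        i≡z refl = subst (λ j → i ∈ₛ ⁅ j ⁆) (sym (strictlyInverseˡ i)) (x∈⁅x⁆ i)

  -- Ranks, counts below a point, and successors

  rank : Carrier → ℕ
  rank x = card (_<? x)

  below : {P : Pred Carrier 0ℓ} → Decidable P → ∀ x → Decidable (λ y → y < x × P y)
  below P? x y = (y <? x) ×-dec P? y

  count : {P : Pred Carrier 0ℓ} → Decidable P → Carrier → ℕ
  count P? x = card (below P? x)

  <-succ⁻ : ∀ {x y z} → Succ x y → z < y → z < x ⊎ z ≡ x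
  <-succ⁻ {x} {y} {z} (x<y , none) z<y with compare z x
  ... | tri< z<x _ _ = inj₁ z<x
  ... | tri≈ _ z≡x _ = inj₂ z≡x
  ... | tri> _ _ x<z = contradiction (z , x<z , z<y) none

  ≢last⇒<last : ∀ {x} → x ≢ last → x < last
  ≢last⇒<last {x} x≢last with compare x last
  ... | tri< x<last _ _ = x<last
  ... | tri≈ _ x≡last _ = contradiction x≡last x≢last
  ... | tri> _ _ last<x = contradiction last<x (max-greatest x)

  rank-mono-< : ∀ {x y} → x < y → rank x ℕ.< rank y
  rank-mono-< {x} {y} x<y =
    card-strict (_<? x) (_<? y) (λ z<x → <-trans z<x x<y) x<y (irrefl refl)

  rank-cancel-< : ∀ {x y} → rank x ℕ.< rank y → x < y
  rank-cancel-< {x} {y} r with compare x y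
  ... | tri< x<y _ _  = x<y
  ... | tri≈ _ refl _ = contradiction r (ℕ.<-irrefl refl)
  ... | tri> _ _ y<x  = contradiction r (ℕ.<-asym (rank-mono-< y<x))

  rank-injective : ∀ {x y} → rank x ≡ rank y → x ≡ y
  rank-injective {x} {y} eq with compare x y
  ... | tri< x<y _ _ = contradiction eq (ℕ.<⇒≢ (rank-mono-< x<y))
  ... | tri≈ _ x≡y _ = x≡y
  ... | tri> _ _ y<x = contradiction (sym eq) (ℕ.<⇒≢ (rank-mono-< y<x))

  rank≤rank-last : ∀ x → rank x ≤ rank last
  rank≤rank-last x with x ≟ last
  ... | yes refl   = ℕ.≤-refl
  ... | no  x≢last = ℕ.<⇒≤ (rank-mono-< (≢last⇒<last x≢last))

  rank-first : rank first ≡ 0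
  rank-first = card-empty (_<? first) min-least

  rank-succ⁺ : ∀ {x y} → Succ x y → rank y ≡ suc (rank x)
  rank-succ⁺ {x} {y} s@(x<y , _) =
    ℕ.≤-antisym (card-insert (_<? x) (_<? y) x (<-succ⁻ s)) (rank-mono-< x<y)

  rank-succ⁻ : ∀ {x y} → rank y ≡ suc (rank x) → Succ x y
  rank-succ⁻ {x} {y} eq =
    rank-cancel-< (ℕ.≤-reflexive (sym eq)) ,
    λ (z , x<z , z<y) → ℕ.<⇒≱ (rank-mono-< z<y) (subst (_≤ rank z) (sym eq) (rank-mono-< x<z))

  succ-exists : ∀ {x} → x ≢ last → ∃ (Succ x)
  succ-exists {x} x≢last with any? (Succ? x)
  ... | yes s  = s
  ... | no  ¬s = contradiction (≢last⇒<last x≢last) (noneAbove _ ℕ.≤-refl)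
    where
    -- If `x` has no successor, every `y` above `x` has some `z` strictly between, of smaller rank;
    -- the descent on a bound `k` for the rank cannot go on forever.
    noneAbove : ∀ k {y} → rank y ≤ k → ¬ x < y
    noneAbove zero    y≤k x<y = ℕ.n≮0 (ℕ.≤-trans (rank-mono-< x<y) y≤k)
    noneAbove (suc k) y≤k x<y = ¬s (_ , x<y , λ (z , x<z , z<y) →
      noneAbove k (ℕ.≤-pred (ℕ.≤-trans (rank-mono-< z<y) y≤k)) x<z)

  module _ (P : Pred Carrier 0ℓ) (base : P first) (step : ∀ {x y} → Succ x y → P x → P y) where

    -- The element of rank `i` is built together with its proof of `P`. A trivial `P` thus gives
    -- surjectivity of `rank`, while injectivity of `rank` turns the statement into induction along
    -- successors.
    climb : ∀ i → i ≤ rank last → ∃ λ x → rank x ≡ i × P x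
    climb zero    _ = first , rank-first , base
    climb (suc i) i<last with x , refl , p ← climb i (ℕ.<⇒≤ i<last)
      with y , s ← succ-exists {x} (λ { refl → ℕ.<-irrefl refl i<last })
      = y , rank-succ⁺ s , step s p

    order-induction : ∀ x → P x
    order-induction x with y , eq , p ← climb (rank x) (rank≤rank-last x) =
      subst P (rank-injective eq) p

  rank-surjective : ∀ i → i ≤ rank last → ∃ λ x → rank x ≡ i
  rank-surjective i i≤ with x , eq , _ ← climb (λ _ → ⊤) tt (λ _ _ → tt) i i≤ = x , eq

  module _ {P : Pred Carrier 0ℓ} (P? : Decidable P) where

    count-first : count P? first ≡ 0
    count-first = card-empty (below P? first) (λ x (x<first , _) → min-least x x<first)

    count≤rank : ∀ x → count P? x ≤ rank x
    count≤rank x = card-mono (below P? x) (_<? x) proj₁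

    count-succ-∈ : ∀ {x y} → Succ x y → P x → count P? y ≡ suc (count P? x)
    count-succ-∈ {x} {y} s@(x<y , _) p = ℕ.≤-antisym
      (card-insert (below P? x) (below P? y) x
        (λ (z<y , q) → Sum.map (_, q) id (<-succ⁻ s z<y)))
      (card-strict (below P? x) (below P? y)
        (λ (z<x , q) → <-trans z<x x<y , q) (x<y , p) (irrefl refl ∘ proj₁))

    count-succ-∉ : ∀ {x y} → Succ x y → ¬ P x → count P? y ≡ count P? x
    count-succ-∉ {x} {y} s@(x<y , _) ¬p = ℕ.≤-antisym
      (card-mono (below P? y) (below P? x)
        (λ (z<y , q) → [ (_, q) , (λ { refl → contradiction q ¬p }) ] (<-succ⁻ s z<y)))
      (card-mono (below P? x) (below P? y) (λ (z<x , q) → <-trans z<x x<y , q))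

  module _ {P Q : Pred Carrier 0ℓ} (P? : Decidable P) (Q? : Decidable Q) (P⊆Q : P ⊆ Q) where

    count-mono : ∀ x → count P? x ≤ count Q? x
    count-mono x = card-mono (below P? x) (below Q? x) (λ (z<x , p) → z<x , P⊆Q p)

    -- An element of `Q` below `x` outside `P` would make the inclusion strict and the counts
    -- different.
    count-≡⇒⊇ : ∀ {x z} → count P? x ≡ count Q? x → z < x → Q z → P z
    count-≡⇒⊇ {x} {z} eq z<x q with P? z
    ... | yes p = p
    ... | no ¬p = contradiction eq (ℕ.<⇒≢ (card-strict (below P? x) (below Q? x)
                    (λ (z<x , p) → z<x , P⊆Q p) (z<x , q) (¬p ∘ proj₂)))

-- Inductive counting as a nondeterministic machine

module Machine (G : Structure graphVocabulary) where
  open Structure G using (Carrier; order; Succ; min≢max; _≟_; any?; _<_; min-least)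
    renaming (min to first; max to last; R? to relation?)
  open Counting order

  private variable
    c d d′ e e′ m m′ t t′ u u′ v v′ w w′ x y : Carrier

  -- Layers of the input graph

  E : Rel Carrier 0ℓ
  E = Edge G

  -- Fewer than i edges, rather than at most i: as the layer 0 is empty, the
  -- machine can start in the configuration of all minima.
  Layer : ℕ → Pred Carrier 0ℓ
  Layer zero    x = ⊥
  Layer (suc i) x = x ≡ first ⊎ ∃ λ w → Layer i w × E w x

  Layer? : ∀ i → Decidable (Layer i)
  Layer? zero    x = no id
  Layer? (suc i) x = x ≟ first ⊎-dec any? λ w → Layer? i w ×-dec relation? zero (w ∷ x ∷ [])

  Layer-mono : ∀ i → Layer i ⊆ Layer (suc i)
  Layer-mono (suc i) (inj₁ eq)           = inj₁ eq
  Layer-mono (suc i) (inj₂ (w , l , wEx)) = inj₂ (w , Layer-mono i l , wEx)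

  Layer⇒reachable : ∀ i → Layer i x → Star E first x
  Layer⇒reachable (suc i) (inj₁ refl)          = ε
  Layer⇒reachable (suc i) (inj₂ (w , l , wEx)) = Layer⇒reachable i l ◅◅ (wEx ◅ ε)

  closed⇒Layer : ∀ i → (∀ {x y} → Layer (suc i) x → E x y → Layer (suc i) y) →
                 Star E first x → Layer (suc i) x
  closed⇒Layer {x} i closed = go (inj₁ refl)
    where
    go : Layer (suc i) y → Star E y x → Layer (suc i) x
    go l ε          = l
    go l (yEz ◅ zx) = go (closed l yEz) zx

  -- Configurations and transitions

  data Goal : Set where
    inner outer : Goal

  -- scan d c e v u m: the layer of d has c elements, e elements of the next
  -- layer precede v, and m elements of the layer of d preceding u have been
  -- guessed (all numbers being ranks), none of which has an edge to v.  A walk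
  -- backwards from w in at most t steps certifies the inner goal that u is in
  -- the layer of d, or the outer goal that v is in the next one.
  data Config : Set where
    scan   : (d c e v u m : Carrier) → Config
    walk   : (g : Goal) (d c e v u m w t : Carrier) → Config
    accept : Config

  private variable
    g : Goal

  infix 4 _⟶_ _⟶*_
  -- Nothing forces `skip` to be honest. But `refute`, `deepen` and `halt`, which rely on a complete
  -- scan, ask for `m` to equal `c` once `u` is `last`, and a scan that skipped an element of the
  -- layer never attains this.
  data _⟶_ : Rel Config 0ℓ where
    skip    : Succ u u′ → scan d c e v u m ⟶ scan d c e v u′ m
    -- The layer of `d` means fewer than `rank d` edges, so the walk starts with the predecessor of
    -- `d` as its clock; `claim`, which concerns the next layer, starts with `d` itself.
    guess   : ¬ E u v → Succ t d → scan d c e v u m ⟶ walk inner d c e v u m u t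
    step    : E w′ w → Succ t′ t → walk g d c e v u m w t ⟶ walk g d c e v u m w′ t′
    found   : Succ u u′ → Succ m m′ → walk inner d c e v u m first t ⟶ scan d c e v u′ m′
    claim   : scan d c e v u m ⟶ walk outer d c e v u m v d
    claimed : Succ v v′ → Succ e e′ →
              walk outer d c e v u m first t ⟶ scan d c e′ v′ first first
    -- `first` is in the next layer without any incoming edge, so the absence of edges from the
    -- layer into `v` is conclusive only for other `v`.
    refute  : v ≢ first → Succ v v′ → scan d c e v last c ⟶ scan d c e v′ first first
    -- The scan completed at `v` equal to `last` shows that `last` is not in the next layer, so `e`,
    -- counting only elements before `last`, is the full size of that layer.
    deepen  : Succ d d′ → scan d c e last last c ⟶ scan d′ e first first first first
    halt    : scan d c c last last c ⟶ accept

  _⟶*_ : Rel Config 0ℓ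
  _⟶*_ = Star _⟶_

  start : Config
  start = scan first first first first first first

  -- Invariants and soundness

  record ScanInvariant (d c e v u m : Carrier) : Set where
    field
      total   : rank c ≡ count (Layer? (rank d)) last
      last∉   : ¬ Layer (rank d) last
      partial : rank e ≡ count (Layer? (suc (rank d))) v
      bound   : rank m ≤ count (Layer? (rank d)) u
      -- By `bound`, a missed element leaves `m` behind the count for the rest of the scan. Equality
      -- therefore means that every element of the layer before `u` was guessed and checked against
      -- `v`.
      tight   : rank m ≡ count (Layer? (rank d)) u →
                ∀ {x} → x < u → Layer (rank d) x → ¬ E x v

  open ScanInvariant

  -- Walks run backwards, so their invariant is an implication from membership of the current vertex
  -- `w` to the goal. Its premise becomes trivial when `w` is `first`.
  Invariant : Config → Set
  Invariant (scan d c e v u m) = ScanInvariant d c e v u m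
  Invariant (walk inner d c e v u m w t) =
    ScanInvariant d c e v u m × ¬ E u v × (Layer (suc (rank t)) w → Layer (rank d) u)
  Invariant (walk outer d c e v u m w t) =
    ScanInvariant d c e v u m × (Layer (suc (rank t)) w → Layer (suc (rank d)) v)
  Invariant accept = ¬ Star E first last

  Layer<last : ∀ i → ¬ Layer i last → Layer i x → x < last
  Layer<last i last∉ l = ≢last⇒<last λ { refl → last∉ l }

  -- Nothing precedes `first`, so resetting `u` and `m` to it makes `bound` and `tight` trivial.
  rescan : rank c ≡ count (Layer? (rank d)) last → ¬ Layer (rank d) last →
           rank e ≡ count (Layer? (suc (rank d))) v → ScanInvariant d c e v first first
  rescan {d = d} total last∉ partial = record
    { total   = total
    ; last∉   = last∉
    ; partial = partial
    ; bound   = ℕ.≤-trans (ℕ.≤-reflexive rank-first) z≤n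
    ; tight   = λ _ x<first → contradiction x<first (min-least _)
    }

  -- Here `total` is exactly the premise of `tight`. As `last` is not in the layer, all elements of
  -- the layer precede `last` and are covered by the scan.
  refuted : ScanInvariant d c e v last c → v ≢ first → ¬ Layer (suc (rank d)) v
  refuted inv v≢first (inj₁ v≡first)     = v≢first v≡first
  refuted inv v≢first (inj₂ (w , l , wEv)) =
    inv .tight (inv .total) (Layer<last _ (inv .last∉) l) l wEv

  -- The two layers are nested, avoid `last` and have equal counts, hence coincide; the layer is
  -- then closed under edges and contains every reachable vertex, but not `last`.
  saturated : ScanInvariant d c c last last c → ¬ Star E first last
  saturated {d} inv = last∉′ ∘ closed⇒Layer (rank d) closed
    where
    last∉′ : ¬ Layer (suc (rank d)) last
    last∉′ = refuted inv (min≢max ∘ sym)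
    closed : Layer (suc (rank d)) x → E x y → Layer (suc (rank d)) y
    closed {x} l xEy = inj₂
      ( x
      , count-≡⇒⊇ (Layer? (rank d)) (Layer? (suc (rank d))) (Layer-mono (rank d))
          (trans (sym (inv .total)) (inv .partial)) (Layer<last _ last∉′ l) l
      , xEy)

  preserved : ∀ {C C′} → C ⟶ C′ → Invariant C → Invariant C′
  preserved (skip {u = u} {d = d} s) inv with Layer? (rank d) u
  ... | yes l = record
    { ScanInvariant inv
    ; bound = ℕ.≤-trans (inv .bound) (ℕ.≤-trans (ℕ.n≤1+n _) (ℕ.≤-reflexive (sym (count-succ-∈ (Layer? (rank d)) s l))))
    -- Skipping an element of the layer raises the count but not `m`, so the premise of `tight` now
    -- contradicts the old `bound`.
    ; tight = λ eq → contradiction (subst (_≤ _) (trans eq (count-succ-∈ (Layer? (rank d)) s l)) (inv .bound)) ℕ.1+n≰n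
    }
  ... | no ¬l = record
    { ScanInvariant inv
    ; bound = ℕ.≤-trans (inv .bound) (ℕ.≤-reflexive (sym (count-succ-∉ (Layer? (rank d)) s ¬l)))
    ; tight = λ eq x<u′ l → [ (λ x<u → inv .tight (trans eq (count-succ-∉ (Layer? (rank d)) s ¬l)) x<u l)
                            , (λ { refl → contradiction l ¬l }) ] (<-succ⁻ s x<u′)
    }
  preserved (guess {u} ¬uEv s) inv =
    inv , ¬uEv , subst (λ i → Layer i u) (sym (rank-succ⁺ s))
  preserved (step {w′} {w} {g = inner} w′Ew s) (inv , ¬uEv , f) =
    inv , ¬uEv , λ l → f (inj₂ (w′ , subst (λ i → Layer i w′) (sym (rank-succ⁺ s)) l , w′Ew))
  preserved (step {w′} {w} {g = outer} w′Ew s) (inv , f) =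
    inv , λ l → f (inj₂ (w′ , subst (λ i → Layer i w′) (sym (rank-succ⁺ s)) l , w′Ew))
  preserved (found su sm) (inv , ¬uEv , f) = record
    { ScanInvariant inv
    ; bound = ℕ.≤-trans (ℕ.≤-reflexive (rank-succ⁺ sm))
                (ℕ.≤-trans (s≤s (inv .bound)) (ℕ.≤-reflexive (sym count≡)))
    ; tight = λ eq x<u′ l →
        [ (λ x<u → inv .tight (ℕ.suc-injective (trans (sym (rank-succ⁺ sm)) (trans eq count≡))) x<u l)
        , (λ { refl → ¬uEv }) ] (<-succ⁻ su x<u′)
    }
    where
    count≡ = count-succ-∈ (Layer? _) su (f (inj₁ refl))
  preserved claim inv = inv , id
  preserved (claimed sv se) (inv , f) = rescan (inv .total) (inv .last∉)
    (trans (rank-succ⁺ se)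
      (trans (cong suc (inv .partial)) (sym (count-succ-∈ (Layer? _) sv (f (inj₁ refl))))))
  preserved (refute v≢first s) inv = rescan (inv .total) (inv .last∉)
    (trans (inv .partial) (sym (count-succ-∉ (Layer? _) s (refuted inv v≢first))))
  preserved (deepen {d} {d′} {e = e} s) inv = rescan
    (subst (λ i → rank e ≡ count (Layer? i) last) (sym (rank-succ⁺ s)) (inv .partial))
    (subst (λ i → ¬ Layer i last) (sym (rank-succ⁺ s)) (refuted inv (min≢max ∘ sym)))
    (trans rank-first (sym (count-first (Layer? (suc (rank d′))))))
  preserved halt inv = saturated inv

  start-invariant : Invariant start
  start-invariant = rescan
    (trans rank-first (sym (card-empty (below (Layer? (rank first)) last) (λ x → ∉Layer-first ∘ proj₂))))
    ∉Layer-first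
    (trans rank-first (sym (count-first (Layer? (suc (rank first))))))
    where
    ∉Layer-first : ¬ Layer (rank first) x
    ∉Layer-first {x} = subst (λ i → ¬ Layer i x) (sym rank-first) id

  invariant* : ∀ {C C′} → C ⟶* C′ → Invariant C → Invariant C′
  invariant* ε        = id
  invariant* (s ◅ ss) = invariant* ss ∘ preserved s

  soundness : start ⟶* accept → ¬ Star E first last
  soundness run = invariant* run start-invariant

  -- Completeness: an accepting run when `last` is unreachable

  module _ (unreachable : ¬ Star E first last) where

    ∉layers : ∀ i → ¬ Layer i last
    ∉layers i = unreachable ∘ Layer⇒reachable i

    walkBack : ∀ i → rank t ≡ i → Layer (suc i) w →
               ∃ λ t′ → walk g d c e v u m w t ⟶* walk g d c e v u m first t′
    walkBack i       eq (inj₁ refl)         = _ , ε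
    walkBack {t} (suc i) eq (inj₂ (w′ , l , w′Ew))
      -- The next clock value exists because `suc i` is already the rank of `t`.
      with t′ , refl ← rank-surjective i (ℕ.<⇒≤ (subst (_≤ rank last) eq (rank≤rank-last t)))
      with t″ , run ← walkBack (rank t′) refl l
      = t″ , step w′Ew (rank-succ⁻ eq) ◅ run

    include : ∀ i → rank d ≡ i → Layer i u → ¬ E u v → Succ u u′ → Succ m m′ →
              scan d c e v u m ⟶* scan d c e v u′ m′
    include {d} (suc i) eq l ¬uEv su sm
      with t , refl ← rank-surjective i (ℕ.<⇒≤ (subst (_≤ rank last) eq (rank≤rank-last d)))
      with _ , run ← walkBack (rank t) refl l
      = guess ¬uEv (rank-succ⁻ eq) ◅ run ◅◅ (found su sm ◅ ε)

    -- Only elements strictly before `x` are counted, so the count is at most `rank x` and is itself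
    -- the rank of a vertex.
    count-witness : ∀ i x → ∃ λ m → rank m ≡ count (Layer? i) x
    count-witness i x = rank-surjective _ (ℕ.≤-trans (count≤rank (Layer? i) x) (rank≤rank-last x))

    -- Since `v` is not in the next layer, no element of the layer has an edge to it: each can be
    -- guessed, and exactly the other vertices are skipped.
    scanAll : ¬ Layer (suc (rank d)) v → ∀ u → ∃ λ m →
              rank m ≡ count (Layer? (rank d)) u × scan d c e v first first ⟶* scan d c e v u m
    scanAll {d} {v} {c} {e} v∉ = order-induction _
      (first , trans rank-first (sym (count-first (Layer? (rank d)))) , ε) extend
      where
      extend : Succ x y →
        (∃ λ m → rank m ≡ count (Layer? (rank d)) x × scan d c e v first first ⟶* scan d c e v x m) →
        (∃ λ m → rank m ≡ count (Layer? (rank d)) y × scan d c e v first first ⟶* scan d c e v y m)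
      extend {x} {y} s (m , eq , run) with Layer? (rank d) x
      ... | no ¬l = m , trans eq (sym (count-succ-∉ (Layer? (rank d)) s ¬l)) , run ◅◅ (skip s ◅ ε)
      ... | yes l with m′ , eq′ ← count-witness (rank d) y
        = m′ , eq′ , run ◅◅ include (rank d) refl l (λ xEv → v∉ (inj₂ (x , l , xEv))) s
            (rank-succ⁻ (trans eq′ (trans (count-succ-∈ (Layer? (rank d)) s l) (cong suc (sym eq)))))

    scanTo-last : rank c ≡ count (Layer? (rank d)) last → ¬ Layer (suc (rank d)) v →
                  scan d c e v first first ⟶* scan d c e v last c
    scanTo-last total v∉ with m , eq , run ← scanAll v∉ last
      with refl ← rank-injective (trans eq (sym total)) = run

    countNext : rank c ≡ count (Layer? (rank d)) last → ∀ v → ∃ λ e →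
                rank e ≡ count (Layer? (suc (rank d))) v ×
                scan d c first first first first ⟶* scan d c e v first first
    countNext {c} {d} total = order-induction _
      (first , trans rank-first (sym (count-first (Layer? (suc (rank d))))) , ε) extend
      where
      extend : Succ x y →
        (∃ λ e → rank e ≡ count (Layer? (suc (rank d))) x ×
                 scan d c first first first first ⟶* scan d c e x first first) →
        (∃ λ e → rank e ≡ count (Layer? (suc (rank d))) y ×
                 scan d c first first first first ⟶* scan d c e y first first)
      extend {x} {y} s (e , eq , run) with Layer? (suc (rank d)) x
      ... | no ¬l = e , trans eq (sym (count-succ-∉ (Layer? (suc (rank d))) s ¬l)) ,
                    run ◅◅ scanTo-last total ¬l ◅◅ (refute (¬l ∘ inj₁) s ◅ ε)
      ... | yes l with e′ , eq′ ← count-witness (suc (rank d)) y | _ , back ← walkBack (rank d) refl l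
        = e′ , eq′ , run ◅◅ claim ◅ back ◅◅
            (claimed s (rank-succ⁻
              (trans eq′ (trans (count-succ-∈ (Layer? (suc (rank d))) s l) (cong suc (sym eq))))) ◅ ε)

    -- Layers are nested, so `e` is at least `c`: either they agree and the machine halts, or the
    -- size has grown strictly. Both outcomes use the scan that excludes `last` from the next layer.
    stage : rank c ≡ count (Layer? (rank d)) last →
            scan d c first first first first ⟶* accept ⊎
            ∃ λ e → rank e ≡ count (Layer? (suc (rank d))) last × rank c ℕ.< rank e ×
                    scan d c first first first first ⟶* scan d c e last last c
    stage {c} {d} total with countNext total last
    ... | e , eq , run with e ≟ c
    ...   | yes refl = inj₁ (run ◅◅ scanTo-last total (∉layers _) ◅◅ (halt ◅ ε))
    ...   | no  e≢c  = inj₂ (e , eq , ℕ.≤∧≢⇒< c≤e (e≢c ∘ sym ∘ rank-injective) ,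
                             run ◅◅ scanTo-last total (∉layers _))
      where
      c≤e : rank c ≤ rank e
      c≤e = subst (rank c ≤_) (sym eq) (subst (_≤ count (Layer? (suc (rank d))) last) (sym total)
        (count-mono (Layer? (rank d)) (Layer? (suc (rank d))) (Layer-mono (rank d)) last))

    -- The sizes of the layers increase strictly as long as the machine does
    -- not halt, so the layer of d then has at least rank d elements.
    completeness : start ⟶* accept
    completeness with order-induction Progress base advance last
      where
      Progress : Pred Carrier 0ℓ
      Progress d = start ⟶* accept ⊎
        ∃ λ c → rank c ≡ count (Layer? (rank d)) last × rank d ≤ rank c ×
                start ⟶* scan d c first first first first

      base : Progress first
      base = inj₂ (first , start-invariant .total , ℕ.≤-refl , ε)

      advance : Succ x y → Progress x → Progress y
      advance s (inj₁ run) = inj₁ run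
      advance {x} {y} s (inj₂ (c , total , d≤c , run)) with stage total
      ... | inj₁ run′ = inj₁ (run ◅◅ run′)
      ... | inj₂ (e , eq , c<e , run′) = inj₂
        ( e
        , trans eq (cong (λ i → count (Layer? i) last) (sym (rank-succ⁺ s)))
        , subst (_≤ rank e) (sym (rank-succ⁺ s)) (ℕ.≤-trans (s≤s d≤c) c<e)
        , run ◅◅ run′ ◅◅ (deepen s ◅ ε))
    ... | inj₁ run = run
    ... | inj₂ (c , total , last≤c , run) with stage total
    ...   | inj₁ run′ = run ◅◅ run′
    -- Another strict increase would push `rank e` above `rank last`, the greatest rank.
    ...   | inj₂ (e , _ , c<e , _) =
      contradiction (ℕ.≤-trans c<e (ℕ.≤-trans (rank≤rank-last e) last≤c)) (ℕ.<-irrefl refl)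

-- The configuration graph as a quantifier-free projection

module Formulas where

  tag₁ tag₂ d c e v u m w t : Fin 10
  tag₁ = 0F
  tag₂ = 1F
  d    = 2F
  c    = 3F
  e    = 4F
  v    = 5F
  u    = 6F
  m    = 7F
  w    = 8F
  t    = 9F

  pre post : Fin 10 → Term 20
  pre  i = var (i ↑ˡ 10)
  post i = var (10 ↑ʳ i)

  infix 8 _≔_
  _≔_ : Fin 10 → Term 20 → Formula graphVocabulary 20
  i ≔ s = post i ≐ s

  keep up down : Fin 10 → Formula graphVocabulary 20
  keep i = i ≔ pre i
  up   i = succ (pre i) (post i)
  down i = succ (post i) (pre i)

  -- The tags distinguish four kinds of configuration, both being `max` for `accept`. A scan has its
  -- spare coordinates `w` and `t` fixed at `min`, so `start` is the least tuple.
  isScan isInner isOuter : (Fin 10 → Term 20) → Formula graphVocabulary 20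
  isScan  x = x tag₁ ≐ min ∧ x tag₂ ≐ min ∧ x w ≐ min ∧ x t ≐ min
  isInner x = x tag₁ ≐ min ∧ x tag₂ ≐ max
  isOuter x = x tag₁ ≐ max ∧ x tag₂ ≐ min

  skipᶠ foundᶠ claimᶠ claimedᶠ refuteᶠ deepenᶠ haltᶠ : Formula graphVocabulary 20
  skipᶠ    = isScan pre ∧ isScan post ∧
             keep d ∧ keep c ∧ keep e ∧ keep v ∧ up u ∧ keep m
  foundᶠ   = isInner pre ∧ isScan post ∧ pre w ≐ min ∧
             keep d ∧ keep c ∧ keep e ∧ keep v ∧ up u ∧ up m
  claimᶠ   = isScan pre ∧ isOuter post ∧
             keep d ∧ keep c ∧ keep e ∧ keep v ∧ keep u ∧ keep m ∧ w ≔ pre v ∧ t ≔ pre d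
  claimedᶠ = isOuter pre ∧ isScan post ∧ pre w ≐ min ∧
             keep d ∧ keep c ∧ up e ∧ up v ∧ u ≔ min ∧ m ≔ min
  refuteᶠ  = isScan pre ∧ isScan post ∧ pre u ≐ max ∧ pre m ≐ pre c ∧ ∼ pre v ≐ min ∧
             keep d ∧ keep c ∧ keep e ∧ up v ∧ u ≔ min ∧ m ≔ min
  deepenᶠ  = isScan pre ∧ isScan post ∧ pre v ≐ max ∧ pre u ≐ max ∧ pre m ≐ pre c ∧
             up d ∧ c ≔ pre e ∧ e ≔ min ∧ v ≔ min ∧ u ≔ min ∧ m ≔ min
  haltᶠ    = isScan pre ∧ (tag₁ ≔ max ∧ tag₂ ≔ max) ∧
             pre e ≐ pre c ∧ pre v ≐ max ∧ pre u ≐ max ∧ pre m ≐ pre c ∧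
             d ≔ max ∧ c ≔ max ∧ e ≔ max ∧ v ≔ max ∧ u ≔ max ∧ m ≔ max ∧ w ≔ max ∧ t ≔ max

  -- Transitions are grouped by the literal they test. Those testing none form the single numeric
  -- disjunct `α₁`, so mutual exclusion concerns just three guards.
  silentᶠ guessᶠ stepᶠ edgeᶠ : Formula graphVocabulary 20
  silentᶠ = skipᶠ ∨ foundᶠ ∨ claimᶠ ∨ claimedᶠ ∨ refuteᶠ ∨ deepenᶠ ∨ haltᶠ
  guessᶠ  = isScan pre ∧ isInner post ∧
            keep d ∧ keep c ∧ keep e ∧ keep v ∧ keep u ∧ keep m ∧ w ≔ pre u ∧ succ (post t) (pre d)
  stepᶠ   = (isInner pre ∧ isInner post ∨ isOuter pre ∧ isOuter post) ∧
            keep d ∧ keep c ∧ keep e ∧ keep v ∧ keep u ∧ keep m ∧ down t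

  no-u→v w′→w : Literal graphVocabulary 20
  no-u→v = neg 0F ((u ↑ˡ 10) ∷ (v ↑ˡ 10) ∷ [])
  w′→w   = pos 0F ((10 ↑ʳ w) ∷ (w ↑ˡ 10) ∷ [])

  edgeᶠ = silentᶠ ∨ (guessᶠ ∧ literal no-u→v) ∨ (stepᶠ ∧ literal w′→w)

  -- Mutual exclusion of the guards

  module _ (A : Structure graphVocabulary) (ρ : Vec (Structure.Carrier A) 20) where

    private
      clash : {x : Structure.Carrier A} → x ≡ Structure.min A → ¬ x ≡ Structure.max A
      clash x≡min x≡max = Structure.min≢max A (trans (sym x≡min) x≡max)

    -- Every silent transition ends in a scan, an outer walk or `accept`, and each of these differs
    -- from an inner walk in a tag.
    silent-∌inner : Sat A ρ silentᶠ → ¬ Sat A ρ (isInner post)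
    silent-∌inner (inj₁ (inj₁ (inj₁ (inj₁ (inj₁ (inj₁ (_ , (_ , q , _) , _))))))) (_ , q′) = clash q q′
    silent-∌inner (inj₁ (inj₁ (inj₁ (inj₁ (inj₁ (inj₂ (_ , (_ , q , _) , _))))))) (_ , q′) = clash q q′
    silent-∌inner (inj₁ (inj₁ (inj₁ (inj₁ (inj₂ (_ , (_ , q) , _))))))            (_ , q′) = clash q q′
    silent-∌inner (inj₁ (inj₁ (inj₁ (inj₂ (_ , (_ , q , _) , _)))))               (_ , q′) = clash q q′
    silent-∌inner (inj₁ (inj₁ (inj₂ (_ , (_ , q , _) , _))))                      (_ , q′) = clash q q′
    silent-∌inner (inj₁ (inj₂ (_ , (_ , q , _) , _)))                             (_ , q′) = clash q q′
    silent-∌inner (inj₂ (_ , (p , _) , _))                                        (p′ , _) = clash p′ p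

    -- Among silent transitions only `claimedᶠ` leaves an outer walk, and it ends in a scan.
    silent-∌outer : Sat A ρ silentᶠ → ¬ (Sat A ρ (isOuter pre) × Sat A ρ (isOuter post))
    silent-∌outer (inj₁ (inj₁ (inj₁ (inj₁ (inj₁ (inj₁ ((p , _) , _)))))))     ((p′ , _) , _) = clash p p′
    silent-∌outer (inj₁ (inj₁ (inj₁ (inj₁ (inj₁ (inj₂ ((p , _) , _)))))))     ((p′ , _) , _) = clash p p′
    silent-∌outer (inj₁ (inj₁ (inj₁ (inj₁ (inj₂ ((p , _) , _))))))            ((p′ , _) , _) = clash p p′
    silent-∌outer (inj₁ (inj₁ (inj₁ (inj₂ (_ , (p , _) , _)))))               (_ , p′ , _)   = clash p p′
    silent-∌outer (inj₁ (inj₁ (inj₂ ((p , _) , _))))                          ((p′ , _) , _) = clash p p′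
    silent-∌outer (inj₁ (inj₂ ((p , _) , _)))                                 ((p′ , _) , _) = clash p p′
    silent-∌outer (inj₂ ((p , _) , _))                                        ((p′ , _) , _) = clash p p′

    silent-guess : ¬ (Sat A ρ silentᶠ × Sat A ρ guessᶠ)
    silent-guess (s , _ , inner , _) = silent-∌inner s inner

    silent-step : ¬ (Sat A ρ silentᶠ × Sat A ρ stepᶠ)
    silent-step (s , inj₁ (_ , inner) , _) = silent-∌inner s inner
    silent-step (s , inj₂ outer       , _) = silent-∌outer s outer

    guess-step : ¬ (Sat A ρ guessᶠ × Sat A ρ stepᶠ)
    guess-step (((_ , q , _) , _) , inj₁ ((_ , q′) , _) , _) = clash q q′
    guess-step (((p , _) , _) , inj₂ ((p′ , _) , _) , _) = clash p p′

  edge-projection : ProjectionForm edgeᶠ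
  edge-projection = record
    { α₁        = silentᶠ
    ; guarded   = (guessᶠ , no-u→v) ∷ (stepᶠ , w′→w) ∷ []
    ; form      = refl
    ; numeric   = _ ∷ _ ∷ _ ∷ []
    ; exclusive = (silent-guess ∷ silent-step ∷ []) ∷ (guess-step ∷ []) ∷ [] ∷ []
    }

  configurationGraph : FOMapping graphVocabulary graphVocabulary
  configurationGraph = record { k = 10 ; formula = λ _ → edgeᶠ }

open Formulas using (edge-projection; configurationGraph)

-- Encoding configurations as tuples

module Encoding (G : Structure graphVocabulary) where
  open Structure G using (Carrier; min≢max; _≟_) renaming (min to first; max to last)
  open Machine G

  graph : Structure graphVocabulary
  graph = FOMapping.apply configurationGraph G

  encode : Config → Vec Carrier 10
  encode (scan d c e v u m) =
    first ∷ first ∷ d ∷ c ∷ e ∷ v ∷ u ∷ m ∷ first ∷ first ∷ []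
  encode (walk inner d c e v u m w t) =
    first ∷ last ∷ d ∷ c ∷ e ∷ v ∷ u ∷ m ∷ w ∷ t ∷ []
  encode (walk outer d c e v u m w t) =
    last ∷ first ∷ d ∷ c ∷ e ∷ v ∷ u ∷ m ∷ w ∷ t ∷ []
  encode accept = replicate 10 last

  -- Tuples that encode no configuration are decoded arbitrarily; by `edge⇒step` they have no edges.
  decode : Vec Carrier 10 → Config
  decode (p ∷ q ∷ d ∷ c ∷ e ∷ v ∷ u ∷ m ∷ w ∷ t ∷ []) with p ≟ first | q ≟ first
  ... | yes _ | yes _ = scan d c e v u m
  ... | yes _ | no  _ = walk inner d c e v u m w t
  ... | no  _ | yes _ = walk outer d c e v u m w t
  ... | no  _ | no  _ = accept

  decode-encode : ∀ C → decode (encode C) ≡ C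
  decode-encode (scan d c e v u m) with first ≟ first
  ... | yes _  = refl
  ... | no  x≢x = contradiction refl x≢x
  decode-encode (walk inner d c e v u m w t) with first ≟ first | last ≟ first
  ... | no  x≢x | _      = contradiction refl x≢x
  ... | yes _ | yes l≡f = contradiction (sym l≡f) min≢max
  ... | yes _ | no  _ = refl
  decode-encode (walk outer d c e v u m w t) with last ≟ first | first ≟ first
  ... | _     | no  x≢x = contradiction refl x≢x
  ... | yes l≡f | yes _ = contradiction (sym l≡f) min≢max
  ... | no  _ | yes _ = refl
  decode-encode accept with last ≟ first
  ... | yes l≡f = contradiction (sym l≡f) min≢max
  ... | no  _ = refl

  step⇒edge : ∀ {C C′} → C ⟶ C′ → Edge graph (encode C) (encode C′)
  step⇒edge (skip s) = inj₁ (inj₁ (inj₁ (inj₁ (inj₁ (inj₁ (inj₁ (inj₁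
    ((refl , refl , refl , refl) , (refl , refl , refl , refl) , refl , refl , refl , refl , s , refl))))))))
  step⇒edge (guess ¬uEv s) = inj₁ (inj₂
    ( ((refl , refl , refl , refl) , (refl , refl) , refl , refl , refl , refl , refl , refl , refl , s)
    , ¬uEv))
  step⇒edge (step {g = inner} w′Ew s) = inj₂
    ((inj₁ ((refl , refl) , refl , refl) , refl , refl , refl , refl , refl , refl , s) , w′Ew)
  step⇒edge (step {g = outer} w′Ew s) = inj₂
    ((inj₂ ((refl , refl) , refl , refl) , refl , refl , refl , refl , refl , refl , s) , w′Ew)
  step⇒edge (found su sm) = inj₁ (inj₁ (inj₁ (inj₁ (inj₁ (inj₁ (inj₁ (inj₂
    ((refl , refl) , (refl , refl , refl , refl) , refl , refl , refl , refl , refl , su , sm))))))))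
  step⇒edge claim = inj₁ (inj₁ (inj₁ (inj₁ (inj₁ (inj₁ (inj₂
    ( (refl , refl , refl , refl) , (refl , refl)
    , refl , refl , refl , refl , refl , refl , refl , refl)))))))
  step⇒edge (claimed sv se) = inj₁ (inj₁ (inj₁ (inj₁ (inj₁ (inj₂
    ((refl , refl) , (refl , refl , refl , refl) , refl , refl , refl , se , sv , refl , refl))))))
  step⇒edge (refute v≢first s) = inj₁ (inj₁ (inj₁ (inj₁ (inj₂
    ( (refl , refl , refl , refl) , (refl , refl , refl , refl)
    , refl , refl , v≢first , refl , refl , refl , s , refl , refl)))))
  step⇒edge (deepen s) = inj₁ (inj₁ (inj₁ (inj₂
    ( (refl , refl , refl , refl) , (refl , refl , refl , refl)
    , refl , refl , refl , s , refl , refl , refl , refl , refl))))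
  step⇒edge halt = inj₁ (inj₁ (inj₂
    ( (refl , refl , refl , refl) , (refl , refl)
    , refl , refl , refl , refl , refl , refl , refl , refl , refl , refl , refl , refl)))

  -- The image of `_⟶_` under `encode`, as an indexed family: matching the equations of an edge
  -- formula with `refl` turns both tuples into encodings.
  data EncodedStep : Rel (Vec Carrier 10) 0ℓ where
    encoded : ∀ {C C′} → C ⟶ C′ → EncodedStep (encode C) (encode C′)

  edge⇒step : ∀ x y → Edge graph x y → EncodedStep x y
  edge⇒step (_ ∷ _ ∷ _ ∷ _ ∷ _ ∷ _ ∷ _ ∷ _ ∷ _ ∷ _ ∷ []) (_ ∷ _ ∷ _ ∷ _ ∷ _ ∷ _ ∷ _ ∷ _ ∷ _ ∷ _ ∷ []) = λ where
    (inj₁ (inj₁ (inj₁ (inj₁ (inj₁ (inj₁ (inj₁ (inj₁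
      ((refl , refl , refl , refl) , (refl , refl , refl , refl) , refl , refl , refl , refl , s , refl)))))))))
      → encoded (skip s)
    (inj₁ (inj₂
      ( ((refl , refl , refl , refl) , (refl , refl) , refl , refl , refl , refl , refl , refl , refl , s)
      , ¬uEv)))
      → encoded (guess ¬uEv s)
    (inj₂ ((inj₁ ((refl , refl) , refl , refl) , refl , refl , refl , refl , refl , refl , s) , w′Ew))
      → encoded (step {g = inner} w′Ew s)
    (inj₂ ((inj₂ ((refl , refl) , refl , refl) , refl , refl , refl , refl , refl , refl , s) , w′Ew))
      → encoded (step {g = outer} w′Ew s)
    (inj₁ (inj₁ (inj₁ (inj₁ (inj₁ (inj₁ (inj₁ (inj₂
      ((refl , refl) , (refl , refl , refl , refl) , refl , refl , refl , refl , refl , su , sm)))))))))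
      → encoded (found su sm)
    (inj₁ (inj₁ (inj₁ (inj₁ (inj₁ (inj₁ (inj₂
      ( (refl , refl , refl , refl) , (refl , refl)
      , refl , refl , refl , refl , refl , refl , refl , refl))))))))
      → encoded claim
    (inj₁ (inj₁ (inj₁ (inj₁ (inj₁ (inj₂
      ((refl , refl) , (refl , refl , refl , refl) , refl , refl , refl , se , sv , refl , refl)))))))
      → encoded (claimed sv se)
    (inj₁ (inj₁ (inj₁ (inj₁ (inj₂
      ( (refl , refl , refl , refl) , (refl , refl , refl , refl)
      , refl , refl , v≢first , refl , refl , refl , s , refl , refl))))))
      → encoded (refute v≢first s)
    (inj₁ (inj₁ (inj₁ (inj₂
      ( (refl , refl , refl , refl) , (refl , refl , refl , refl)
      , refl , refl , refl , s , refl , refl , refl , refl , refl)))))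
      → encoded (deepen s)
    (inj₁ (inj₁ (inj₂
      ( (refl , refl , refl , refl) , (refl , refl)
      , refl , refl , refl , refl , refl , refl , refl , refl , refl , refl , refl , refl))))
      → encoded halt

  decode-edge : ∀ x y → Edge graph x y → decode x ⟶ decode y
  decode-edge x y xEy with encoded {C} {C′} s ← edge⇒step x y xEy =
    subst₂ _⟶_ (sym (decode-encode C)) (sym (decode-encode C′)) s

  -- The least and greatest tuples are by computation `encode start` and `encode accept`, so
  -- decoding a path edge by edge gives the run.
  reaches⇒run : REACH graph → start ⟶* accept
  reaches⇒run = subst₂ _⟶*_ (decode-encode start) (decode-encode accept) ∘ gmap decode (λ {x} {y} → decode-edge x y)

  run⇒reaches : start ⟶* accept → REACH graph
  run⇒reaches = gmap encode step⇒edge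

mainTheorem1 : ∁ REACH ≤qfp REACH
mainTheorem1 =
  configurationGraph
  , (λ G → mk⇔ (Encoding.run⇒reaches G ∘ Machine.completeness G)
               (Machine.soundness G ∘ Encoding.reaches⇒run G))
  , (λ _ → edge-projection)
  , _
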